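{- Let $X$ and $Y$ be graphs. Then the following hold: (i) $\mathrm{LSur}(X,Y)\subseteq\mathrm{LS}(X,Y)$; (ii) $\mathrm{LS}(X,Y)\cap\mathrm{Sur}(X,Y)=\mathrm{LSur}(X,Y)\cap\mathrm{Sur}(X,Y)$.
   Context: All graphs are finite, undirected, simple and reflexive: a graph $X=(V_X,E_X)$ has a finite nonempty vertex set $V_X$, and $E_X$ consists of all loops $\{x\}$ ($x\in V_X$; written $\{x,x\}$) together with a (possibly empty) set of $2$-element subsets of $V_X$. A homomorphism $\varphi:X\to Y$ is a map $\varphi:V_X\to V_Y$ such that $\{x_1,x_2\}\in E_X$ implies $\{\varphi(x_1),\varphi(x_2)\}\in E_Y$. $N_X(x)=\{u\in V_X:\{x,u\}\in E_X\}$ (so $x\in N_X(x)$). $\mathrm{Sur}(X,Y)$ is the set of homomorphisms $X\to Y$ that are surjective on vertices. $\mathrm{LSur}(X,Y)$ is the set of locally surjective homomorphisms, i.e. those with $\varphi(N_X(x))=N_Y(\varphi(x))$ for all $x\in V_X$. $\mathrm{LS}(X,Y)$ is the set of locally strong homomorphisms, i.e. those such that for all $x_1,x_2\in V_X$, $\{\varphi(x_1),\varphi(x_2)\}\in E_Y$ implies that for every $\tilde x_1\in\varphi^{ -1}(\varphi(x_1))$ there exists $\tilde x_2\in\varphi^{ -1}(\varphi(x_2))$ with $\{\tilde x_1,\tilde x_2\}\in E_X$. -}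

module Defs where

open import Data.Fin.Base using (Fin)
open import Data.Nat.Base using (ℕ)
open import Data.Product.Base using (∃; _×_)
open import Function.Bundles using (_↔_)
open import Function.Definitions using (Surjective)
open import Level using (0ℓ)
open import Relation.Binary.Core using (Rel)
open import Relation.Binary.Definitions using (Reflexive; Symmetric; Decidable)
open import Relation.Binary.PropositionalEquality.Core using (_≡_)
open import Relation.Unary using (Pred; _∈_; _≐_)

-- Finite, undirected, simple, reflexive graphs.  E x y says that the
-- unordered pair {x , y} is an edge; {x , x} is a loop, and every loop is
-- present.  Only the inhabitation of E x y is ever used, so multiplicities
-- play no role.  Decidability of E expresses that the edge set is a finite set.
record Graph : Set₁ where
  field
    V        : Set
    order    : ℕ
    finite   : V ↔ Fin order
    nonempty : V
    E        : Rel V 0ℓ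
    E-refl   : Reflexive E
    E-sym    : Symmetric E
    E-dec    : Decidable E

open Graph public using (V; E)

N : (X : Graph) → V X → Pred (V X) 0ℓ
N X x u = E X x u

_[_] : {A B : Set} → (A → B) → Pred A 0ℓ → Pred B 0ℓ
(f [ P ]) b = ∃ λ a → a ∈ P × f a ≡ b

_⁻¹⟨_⟩ : {A B : Set} → (A → B) → B → Pred A 0ℓ
(f ⁻¹⟨ b ⟩) a = f a ≡ b

-- Sets of homomorphisms are predicates on the maps between vertex sets.
module _ (X Y : Graph) where

  Hom : Pred (V X → V Y) 0ℓ
  Hom φ = ∀ x₁ x₂ → E X x₁ x₂ → E Y (φ x₁) (φ x₂)

  Sur : Pred (V X → V Y) 0ℓ
  Sur φ = φ ∈ Hom × Surjective _≡_ _≡_ φ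

  LSur : Pred (V X → V Y) 0ℓ
  LSur φ = φ ∈ Hom × (∀ x → (φ [ N X x ]) ≐ N Y (φ x))

  LS : Pred (V X → V Y) 0ℓ
  LS φ = φ ∈ Hom ×
    (∀ x₁ x₂ → E Y (φ x₁) (φ x₂) →
      ∀ x̃₁ → x̃₁ ∈ (φ ⁻¹⟨ φ x₁ ⟩) →
      ∃ λ x̃₂ → x̃₂ ∈ (φ ⁻¹⟨ φ x₂ ⟩) × E X x̃₁ x̃₂)

{-# OPTIONS --safe #-}
module Submission where

open import Defs
open import Data.Product.Base using (_×_; _,_)
open import Relation.Binary.PropositionalEquality.Core using (refl; sym; subst)
open import Relation.Unary using (_⊆_; _∩_; _≐_)

-- Both conditions lift an edge of `Y` at `φ x` to an edge of `X` at `x`: local surjectivity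
-- whatever its far end, strongness only when that end lies in the image of `φ`. Surjectivity
-- removes this difference.

LSur⊆LS : (X Y : Graph) → LSur X Y ⊆ LS X Y
LSur⊆LS X Y {φ} (hom , nbhd) = hom , λ x₁ x₂ e x̃₁ φx̃₁≡φx₁ →
  let (_ , onto)           = nbhd x̃₁
      -- The edge must start at `φ x̃₁` to be lifted at `x̃₁`, hence the transport along the fibre.
      (x̃₂ , e̅ , φx̃₂≡φx₂) = onto (subst (λ y → E Y y (φ x₂)) (sym φx̃₁≡φx₁) e)
  in x̃₂ , φx̃₂≡φx₂ , e̅

LS∩Sur⊆LSur : (X Y : Graph) → (LS X Y ∩ Sur X Y) ⊆ LSur X Y
LS∩Sur⊆LSur X Y {φ} ((hom , strong) , (_ , surj)) = hom , λ x → into x , onto x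
  where
  into : ∀ x → (φ [ N X x ]) ⊆ N Y (φ x)
  into x (u , e , refl) = hom x u e

  onto : ∀ x → N Y (φ x) ⊆ (φ [ N X x ])
  -- A preimage `u` of `y` need not be adjacent to `x`; it only makes `strong` applicable, which
  -- replaces it by a neighbour `v` of `x` in the same fibre.
  onto x {y} e with surj y
  ... | u , φu≡y with φu≡y refl
  ...   | refl = let (v , φv≡φu , e̅) = strong x u e x refl in v , e̅ , φv≡φu

lemma5p6 : (X Y : Graph) → (LSur X Y ⊆ LS X Y) × ((LS X Y ∩ Sur X Y) ≐ (LSur X Y ∩ Sur X Y))
lemma5p6 X Y =
    LSur⊆LS X Y
  , (λ { (ls , sur) → LS∩Sur⊆LSur X Y (ls , sur) , sur })
  , (λ { (lsur , sur) → LSur⊆LS X Y lsur , sur })
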